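{- For every positive integer $k$, let $n = 5k-2\lceil\sqrt{2k-1}\rceil-3$. Then there exists a 2-edge-coloring (red/blue) of the complete graph $K_n$ such that there is no $k$-connected monochromatic subgraph containing at least $n-2k+2$ vertices.
   Context: A graph is $k$-connected if it has more than $k$ vertices and has no vertex cut of size at most $k-1$. A monochromatic subgraph is a subgraph all of whose edges have the same color. -}

module Defs where

open import Data.Nat using (ℕ; _+_; _*_; _≤_; _<_)
open import Data.Fin using (Fin)
open import Data.Fin.Subset using (Subset; _∈_; _⊆_; _─_; ∣_∣)
open import Data.Bool using (Bool)
open import Data.Product using (_×_)
open import Data.Sum using (_⊎_)
open import Relation.Binary.PropositionalEquality using (_≡_; _≢_)

IsCeilSqrt : ℕ → ℕ → Set
IsCeilSqrt m s = (m ≤ s * s) × (∀ t → m ≤ t * t → s ≤ t)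

-- A 2-edge-colouring of K_n: colour c u v (Bool = red/blue) of the edge uv,
-- required to be symmetric (diagonal values are irrelevant).
Coloring : ℕ → Set
Coloring n = Fin n → Fin n → Bool

Symmetric : ∀ {n} → Coloring n → Set
Symmetric c = ∀ u v → c u v ≡ c v u

-- A subgraph H of K_n is given by a vertex set S and an edge relation E
-- (E u v means uv is an edge of H; undirected adjacency is E u v ⊎ E v u).
-- H is a monochromatic subgraph of colour col: all its edges join distinct
-- vertices of S and have colour col.
MonochromaticSubgraph : ∀ {n} → Coloring n → Bool → Subset n → (Fin n → Fin n → Set) → Set
MonochromaticSubgraph {n} c col S E =
  ∀ (u v : Fin n) → E u v → (u ∈ S) × (v ∈ S) × (u ≢ v) × (c u v ≡ col)

Adj : ∀ {n} → (Fin n → Fin n → Set) → Fin n → Fin n → Set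
Adj E u v = E u v ⊎ E v u

data Walk {n : ℕ} (V : Subset n) (E : Fin n → Fin n → Set) : Fin n → Fin n → Set where
  here : ∀ {u} → Walk V E u u
  step : ∀ {u v w} → Adj E u v → v ∈ V → Walk V E v w → Walk V E u w

Connected : ∀ {n} → Subset n → (Fin n → Fin n → Set) → Set
Connected {n} V E = ∀ (u v : Fin n) → u ∈ V → v ∈ V → Walk V E u v

KConnected : ∀ {n} → ℕ → Subset n → (Fin n → Fin n → Set) → Set
KConnected {n} k S E =
  (k < ∣ S ∣) × (∀ (X : Subset n) → X ⊆ S → ∣ X ∣ < k → Connected (S ─ X) E)

{-# OPTIONS --safe #-}

-- Split the vertices into blocks A₁, A₂, A₃, A₄, B.  Between the Aᵢ, red is the path
-- A₁A₂A₃A₄ and blue the complementary path A₂A₄A₁A₃; B is red to A₂, A₃ and blue to A₁, A₄.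
-- A set whose outside neighbourhood in one colour has fewer than k vertices cannot meet a
-- large k-connected subgraph of that colour.
--
-- If n ≤ 4(k − 1), take B empty and every block of size at most k − 1: then no k-connected
-- monochromatic subgraph exists at all.  Otherwise k ≥ 2s.  With sizes |A₁| = |A₂| = k − 1,
-- |A₃| = |A₄| = k − m, |B| = k − 1 − ρ, cut A₂ and A₄ into m pieces of size at most ρ and
-- choose t₁, …, tₘ in A₃ and u₁, …, uₘ in A₁.  Recolour blue the edges from the i-th piece of
-- A₂ to tⱼ, and red those from the i-th piece of A₄ to uⱼ, for i ≠ j.  A₁, A₂ are red inside,
-- A₃, A₄ blue.  In blue one discards A₂ vertex by vertex, then A₃ as a whole (its neighbourhood
-- is now A₁), then each uⱼ (which sees only the j-th piece of A₄ and B): 2k − 1 vertices in all.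
-- In red the same happens with A₄, A₁ and the tⱼ.  This needs mρ ≥ k − 1, and n is then
-- 5k − 3 − (2m + ρ), so one balances 2m against ρ.
module Submission where

open import Defs
open import Data.Nat using (ℕ; zero; suc; _+_; _*_; _∸_; _⊓_; _≤_; _<_; z≤n; s≤s; s≤s⁻¹; _≤?_)
open import Data.Nat.Properties
open import Data.Nat.Tactic.RingSolver using (solve-∀)
open import Data.Fin using (Fin; toℕ; fromℕ<; inject≤; combine; remQuot; punchIn; punchOut)
import Data.Fin as Fin
open import Data.Fin.Properties using (+↔⊎; combine-remQuot; punchIn-punchOut; toℕ-inject≤; toℕ<n; fromℕ<-toℕ; fromℕ<-cong)
open import Data.Fin.Subset using (Subset; ∣_∣; ⁅_⁆; _∪_; _∩_; _─_; _∈_; _∉_; _⊆_; inside; outside)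
import Data.Fin.Subset as Subset
open import Data.Fin.Subset.Properties
open import Data.Vec using ([]; _∷_; here; there)
open import Data.Vec.Properties using (lookup⇒[]=; []=⇒lookup; lookup∘tabulate)
import Data.Vec as Vec
import Data.Bool as Bool
open import Data.Bool using (Bool; true; false; not; _∨_)
open import Data.Bool.Properties using (∨-comm; T?)
open import Data.List using (List; []; _∷_; _++_; length; map; tabulate; mapMaybe)
open import Data.List.Properties using (length-map; length-++; length-tabulate; length-mapMaybe)
open import Data.List.Relation.Unary.Any using (here; there)
import Data.List.Membership.Propositional as List
open import Data.List.Membership.Propositional.Properties using (∈-map⁺; ∈-++⁺ˡ; ∈-++⁺ʳ; ∈-tabulate⁺)
open import Data.Maybe using (Maybe; just; nothing)
open import Data.Product using (Σ; ∃; _×_; _,_; proj₁; proj₂)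
open import Data.Sum using (_⊎_; inj₁; inj₂)
open import Data.Sum.Function.Propositional using (_⊎-↔_)
open import Data.Empty using (⊥; ⊥-elim)
open import Function using (_∘_; _↔_; Inverse)
open import Function.Properties.Inverse using (↔-refl; ↔-trans)
open import Relation.Nullary using (¬_; Dec; yes; no; does)
open import Relation.Nullary.Decidable using (map′; dec-true)
open import Relation.Unary using (Decidable)
open import Relation.Binary.PropositionalEquality using (_≡_; _≢_; refl; sym; trans; cong; subst; module ≡-Reasoning)

-- Cardinalities of finite subsets and of lists.

∣p∪q∣≤∣p∣+∣q∣ : ∀ {n} (p q : Subset n) → ∣ p ∪ q ∣ ≤ ∣ p ∣ + ∣ q ∣
∣p∪q∣≤∣p∣+∣q∣ []            []            = z≤n
∣p∪q∣≤∣p∣+∣q∣ (outside ∷ p) (outside ∷ q) = ∣p∪q∣≤∣p∣+∣q∣ p q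
∣p∪q∣≤∣p∣+∣q∣ (outside ∷ p) (inside  ∷ q) =
  ≤-trans (s≤s (∣p∪q∣≤∣p∣+∣q∣ p q)) (≤-reflexive (sym (+-suc ∣ p ∣ ∣ q ∣)))
∣p∪q∣≤∣p∣+∣q∣ (inside  ∷ p) (outside ∷ q) = s≤s (∣p∪q∣≤∣p∣+∣q∣ p q)
∣p∪q∣≤∣p∣+∣q∣ (inside  ∷ p) (inside  ∷ q) =
  s≤s (≤-trans (∣p∪q∣≤∣p∣+∣q∣ p q) (+-monoʳ-≤ ∣ p ∣ (n≤1+n ∣ q ∣)))

x∈p─q⇒x∉q : ∀ {n} (p q : Subset n) {x} → x ∈ p ─ q → x ∉ q
x∈p─q⇒x∉q (_ ∷ p) (_ ∷ q)      (there x∈) (there x∈q) = x∈p─q⇒x∉q p q x∈ x∈q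
x∈p─q⇒x∉q (_ ∷ p) (inside ∷ q) ()         here

fromList : ∀ {n} → List (Fin n) → Subset n
fromList []       = Subset.⊥
fromList (x ∷ xs) = ⁅ x ⁆ ∪ fromList xs

∈-fromList : ∀ {n} {x : Fin n} {xs} → x List.∈ xs → x ∈ fromList xs
∈-fromList {xs = x ∷ xs} (here refl) = x∈p∪q⁺ {p = ⁅ x ⁆} (inj₁ (x∈⁅x⁆ x))
∈-fromList {xs = x ∷ xs} (there x∈)  = x∈p∪q⁺ {p = ⁅ x ⁆} (inj₂ (∈-fromList x∈))

∣fromList∣≤length : ∀ {n} (xs : List (Fin n)) → ∣ fromList xs ∣ ≤ length xs
∣fromList∣≤length {n} []   = ≤-reflexive (∣⊥∣≡0 n)
∣fromList∣≤length (x ∷ xs) = ≤-trans (∣p∪q∣≤∣p∣+∣q∣ ⁅ x ⁆ (fromList xs))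
  (+-mono-≤ (≤-reflexive (∣⁅x⁆∣≡1 x)) (∣fromList∣≤length xs))

-- Upper bounds on the size of a predicate.

-- The bound is witnessed by a covering list, which may repeat or contain extra elements. Unions
-- then become concatenations and images become `map`.
record AtMost {A : Set} (P : A → Set) (N : ℕ) : Set where
  constructor cover
  field
    elements : List A
    length≤  : length elements ≤ N
    complete : ∀ x → P x → x List.∈ elements

Image : {A B : Set} → (A → B) → (A → Set) → B → Set
Image f P y = ∃ λ x → P x × f x ≡ y

Range : {A B : Set} → (A → B) → B → Set
Range f y = ∃ λ x → f x ≡ y

atMost-range : ∀ {A : Set} {N} (f : Fin N → A) → AtMost (Range f) N
atMost-range f = cover (tabulate f) (≤-reflexive (length-tabulate f)) λ { _ (i , refl) → ∈-tabulate⁺ i }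

atMost-image : ∀ {A B : Set} {P : A → Set} {N} (f : A → B) → AtMost P N → AtMost (Image f P) N
atMost-image f (cover xs len cov) =
  cover (map f xs) (≤-trans (≤-reflexive (length-map f xs)) len) λ { _ (x , Px , refl) → ∈-map⁺ f (cov x Px) }

atMost-⊆ : ∀ {A : Set} {P Q : A → Set} {N} → (∀ x → P x → Q x) → AtMost Q N → AtMost P N
atMost-⊆ P⊆Q (cover xs len cov) = cover xs len λ x Px → cov x (P⊆Q x Px)

atMost-∪ : ∀ {A : Set} {P Q R : A → Set} {M N} → (∀ x → P x → Q x ⊎ R x) →
  AtMost Q M → AtMost R N → AtMost P (M + N)
atMost-∪ P⊆ (cover xs len cov) (cover ys len′ cov′) =
  cover (xs ++ ys) (≤-trans (≤-reflexive (length-++ xs)) (+-mono-≤ len len′)) covered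
  where
  covered : ∀ x → _ → x List.∈ xs ++ ys
  covered x Px with P⊆ x Px
  ... | inj₁ Qx = ∈-++⁺ˡ (cov x Qx)
  ... | inj₂ Rx = ∈-++⁺ʳ xs (cov′ x Rx)

atMost-≤ : ∀ {A : Set} {P : A → Set} {M N} → M ≤ N → AtMost P M → AtMost P N
atMost-≤ M≤N (cover xs len cov) = cover xs (≤-trans len M≤N) cov

atMost-block : ∀ {A : Set} {P : A → Set} {M N} (f : Fin M → A) → M ≤ N → (∀ x → P x → Range f x) → AtMost P N
atMost-block f M≤N P⊆ = atMost-⊆ P⊆ (atMost-≤ M≤N (atMost-range f))

atMost-≡ : ∀ {A : Set} (z : A) → AtMost (_≡ z) 1
atMost-≡ z = cover (z ∷ []) ≤-refl λ _ → here

-- `punchIn i` enumerates everything but `i`. This is the source of the `μ` in the neighbourhood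
-- bounds: a piece is recoloured towards all of the `suc μ` chosen vertices except its own.
atMost-≢ : ∀ {m} (i : Fin (suc m)) → AtMost (_≢ i) m
atMost-≢ i = atMost-⊆ (λ j j≢i → punchOut (j≢i ∘ sym) , punchIn-punchOut (j≢i ∘ sym)) (atMost-range (punchIn i))

-- Cutting a block into pieces of bounded size.

Pieces : (q m r : ℕ) → Set
Pieces q m r = Σ (Fin q → Fin m) λ piece → ∀ i → AtMost (λ x → piece x ≡ i) r

-- Embed `Fin q` into an `m` by `r` grid and let the piece of a vertex be its row, which has `r`
-- cells.
pieces : ∀ {q m r} → q ≤ m * r → Pieces q m r
pieces {q} {m} {r} q≤mr = piece , λ i → atMost-restrict (atMost-⊆ (fibre i) (atMost-range (combine i)))
  where
  ι : Fin q → Fin (m * r)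
  ι x = inject≤ x q≤mr

  piece : Fin q → Fin m
  piece x = proj₁ (remQuot {m} r (ι x))

  fibre : ∀ i y → proj₁ (remQuot {m} r y) ≡ i → Range (combine i) y
  fibre i y refl = proj₂ (remQuot {m} r y) , combine-remQuot {m} r y

  -- A partial inverse of `ι`, so that `mapMaybe` turns a list covering a row into one covering the
  -- piece without lengthening it.
  restrict : Fin (m * r) → Maybe (Fin q)
  restrict y with suc (toℕ y) ≤? q
  ... | yes y<q = just (fromℕ< y<q)
  ... | no _    = nothing

  restrict-ι : ∀ x → restrict (ι x) ≡ just x
  restrict-ι x with suc (toℕ (ι x)) ≤? q
  ... | yes p = cong just (trans (fromℕ<-cong _ _ (toℕ-inject≤ x q≤mr) p (toℕ<n x)) (fromℕ<-toℕ x (toℕ<n x)))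
  ... | no ¬p = ⊥-elim (¬p (subst (_< q) (sym (toℕ-inject≤ x q≤mr)) (toℕ<n x)))

  ∈-restrict : ∀ {x ys} → ι x List.∈ ys → x List.∈ mapMaybe restrict ys
  ∈-restrict {x} {y ∷ ys} (here refl) rewrite restrict-ι x = here refl
  ∈-restrict {x} {y ∷ ys} (there x∈) with restrict y
  ... | just _  = there (∈-restrict x∈)
  ... | nothing = ∈-restrict x∈

  atMost-restrict : ∀ {P : Fin (m * r) → Set} {N} → AtMost P N → AtMost (P ∘ ι) N
  atMost-restrict (cover ys len cov) =
    cover (mapMaybe restrict ys) (≤-trans (length-mapMaybe restrict ys) len) λ x Px → ∈-restrict (cov (ι x) Px)

-- Discarding vertices from a k-connected monochromatic subgraph.

-- The threshold `∣ S ∣ ≥ n - 2k + 2` is written additively, away from truncated subtraction.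
Avoidable : (k n : ℕ) → Set₁
Avoidable k n = Σ (Coloring n) λ c → Symmetric c ×
  (∀ (col : Bool) (S : Subset n) (E : Fin n → Fin n → Set) →
    MonochromaticSubgraph c col S E → KConnected k S E → n + 2 ≤ ∣ S ∣ + 2 * k → ⊥)

-- The vertices are transported to a disjoint union `W` of blocks, where colourings and
-- neighbourhoods can be given by pattern matching.
module Peeling {n k : ℕ} {W : Set} (iso : Fin n ↔ W) (χ : W → W → Bool) (χ-sym : ∀ x y → χ x y ≡ χ y x)
  {col : Bool} {S : Subset n} {E : Fin n → Fin n → Set}
  (mono : MonochromaticSubgraph (λ u v → χ (Inverse.to iso u) (Inverse.to iso v)) col S E)
  (conn : KConnected k S E) where

  open Inverse iso using (to; from; strictlyInverseˡ; strictlyInverseʳ)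

  InS : W → Set
  InS w = from w ∈ S

  to-InS : ∀ {v} → v ∈ S → InS (to v)
  to-InS = subst (_∈ S) (sym (strictlyInverseʳ _))

  adj-colour : ∀ {u v} → Adj E u v → v ∈ S × χ (to u) (to v) ≡ col
  adj-colour {u} {v} (inj₁ e) with mono u v e
  ... | _ , v∈S , _ , eq = v∈S , eq
  adj-colour {u} {v} (inj₂ e) with mono v u e
  ... | v∈S , _ , _ , eq = v∈S , trans (χ-sym (to u) (to v)) eq

  covered⇒∣p∣≤ : ∀ {P : W → Set} {N} (p : Subset n) → (∀ v → v ∈ p → P (to v)) → AtMost P N → ∣ p ∣ ≤ N
  covered⇒∣p∣≤ p p⊆P (cover xs len cov) = ≤-trans (p⊆q⇒∣p∣≤∣q∣ p⊆xs)
    (≤-trans (∣fromList∣≤length (map from xs)) (≤-trans (≤-reflexive (length-map from xs)) len))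
    where
    p⊆xs : p ⊆ fromList (map from xs)
    p⊆xs {v} v∈p = ∈-fromList (subst (List._∈ map from xs) (strictlyInverseʳ v) (∈-map⁺ from (cov (to v) (p⊆P v v∈p))))

  ∣S∣≤ : ∀ {P : W → Set} {N} → (∀ w → InS w → P w) → AtMost P N → ∣ S ∣ ≤ N
  ∣S∣≤ S⊆P = covered⇒∣p∣≤ S (λ v v∈S → S⊆P (to v) (to-InS v∈S))

  -- Deleting `Q` removes fewer than `k` vertices, so `S` stays connected. A walk from `z` could
  -- leave `Z` only through `Q`, hence it stays in `Z` and all of `S` lies in `Z` or `Q`.
  cut : ∀ {Z Q : W → Set} {N} → Decidable Q → AtMost Q N → N < k →
    (∀ x y → Z x → InS y → χ x y ≡ col → Z y ⊎ Q y) →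
    ∀ {z} → Z z → ¬ Q z → InS z → ∀ y → InS y → Z y ⊎ Q y
  cut {Z} {Q} Q? (cover xs len cov) N<k closed {z} Zz ¬Qz z∈S y y∈S with Q? y
  ... | yes Qy = inj₂ Qy
  ... | no ¬Qy = inj₁ (subst Z (strictlyInverseˡ y)
                   (stays (subst Z (sym (strictlyInverseˡ z)) Zz)
                     (proj₂ conn X (p∩q⊆p S C) ∣X∣<k (from z) (from y) (∈S─X z z∈S ¬Qz) (∈S─X y y∈S ¬Qy))))
    where
    C X : Subset n
    C = Vec.tabulate (does ∘ Q? ∘ to)
    -- `KConnected` admits only cut sets inside `S`, hence the intersection.
    X = S ∩ C

    ∈C⇒Q : ∀ {v} → v ∈ C → Q (to v)
    ∈C⇒Q {v} v∈C with Q? (to v) | trans (sym (lookup∘tabulate (does ∘ Q? ∘ to) v)) ([]=⇒lookup v∈C)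
    ... | yes Qv | _ = Qv

    Q⇒∈C : ∀ {v} → Q (to v) → v ∈ C
    Q⇒∈C {v} Qv = lookup⇒[]= v C (trans (lookup∘tabulate (does ∘ Q? ∘ to) v) (dec-true (Q? (to v)) Qv))

    ∣X∣<k : ∣ X ∣ < k
    ∣X∣<k = ≤-<-trans (covered⇒∣p∣≤ X (λ v v∈X → ∈C⇒Q (proj₂ (x∈p∩q⁻ S C v∈X))) (cover xs len cov)) N<k

    ∈S─X : ∀ w → InS w → ¬ Q w → from w ∈ S ─ X
    ∈S─X w w∈S ¬Qw = x∈p∧x∉q⇒x∈p─q w∈S
      (λ w∈X → ¬Qw (subst Q (strictlyInverseˡ w) (∈C⇒Q (proj₂ (x∈p∩q⁻ S C w∈X)))))

    stays : ∀ {u v} → Z (to u) → Walk (S ─ X) E u v → Z (to v)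
    stays Zu here = Zu
    stays {u} Zu (step {v = v} adj v∈ walk) with adj-colour adj
    ... | v∈S , eq with closed (to u) (to v) Zu (to-InS v∈S) eq
    ...   | inj₁ Zv = stays Zv walk
    ...   | inj₂ Qv = ⊥-elim (x∈p─q⇒x∉q S X v∈ (x∈p∩q⁺ (v∈S , Q⇒∈C Qv)))

  -- If `S` met `Z`, then by `cut` it would be covered by `Z` and `Q`, which together are too small.
  peel-set : ∀ {Z Q : W → Set} {M N} → Decidable Q → AtMost Z M → AtMost Q N → N < k → M + N < ∣ S ∣ →
    (∀ x y → Z x → InS y → χ x y ≡ col → Z y ⊎ Q y) → (∀ z → Z z → ¬ Q z) →
    ∀ z → Z z → ¬ InS z
  peel-set Q? Z≤M Q≤N N<k big closed disj z Zz z∈S = <⇒≱ big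
    (∣S∣≤ (cut Q? Q≤N N<k closed Zz (disj z Zz) z∈S) (atMost-∪ (λ _ z → z) Z≤M Q≤N))

  peel-vertex : ∀ {Q : W → Set} {z N} → Decidable Q → AtMost Q N → N < k → ¬ Q z →
    (∀ y → InS y → χ z y ≡ col → Q y) → ¬ InS z
  peel-vertex {z = z} Q? Q≤N N<k ¬Qz nbrs =
    -- For a single vertex the size condition `1 + N < ∣ S ∣` is automatic from `N < k < ∣ S ∣`.
    peel-set Q? (atMost-≡ z) Q≤N N<k (≤-<-trans N<k (proj₁ conn))
      (λ { _ y refl y∈S eq → inj₂ (nbrs y y∈S eq) }) (λ { _ refl → ¬Qz }) z refl

-- Colour classes laid out along a path of four small blocks.

-- Positions along a four-vertex path  end true – mid true – mid false – end false,
-- with a loop at each end.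
data Pos : Set where
  end mid : Bool → Pos

data _~_ : Pos → Pos → Set where
  end~end : ∀ {b} → end b ~ end b
  end~mid : ∀ {b} → end b ~ mid b
  mid~end : ∀ {b} → mid b ~ end b
  mid~mid : ∀ {b} → mid b ~ mid (not b)

¬mid~mid : ∀ {b} → ¬ (mid b ~ mid b)
¬mid~mid {true}  ()
¬mid~mid {false} ()

_≟ᴾ_ : (p q : Pos) → Dec (p ≡ q)
end a ≟ᴾ end b = map′ (cong end) (λ { refl → refl }) (a Bool.≟ b)
mid a ≟ᴾ mid b = map′ (cong mid) (λ { refl → refl }) (a Bool.≟ b)
end _ ≟ᴾ mid _ = no λ ()
mid _ ≟ᴾ end _ = no λ ()

module _ {n k : ℕ} {W : Set} (iso : Fin n ↔ W) (χ : W → W → Bool) (χ-sym : ∀ x y → χ x y ≡ χ y x)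
  {col : Bool} {S : Subset n} {E : Fin n → Fin n → Set}
  (mono : MonochromaticSubgraph (λ u v → χ (Inverse.to iso u) (Inverse.to iso v)) col S E)
  (conn : KConnected k S E)
  {K : ℕ} (K<k : K < k) (pos : W → Pos) (small : ∀ p → AtMost (λ w → pos w ≡ p) K)
  (path : ∀ x y → χ x y ≡ col → pos x ~ pos y) where

  open Peeling iso χ χ-sym mono conn

  -- If `S` meets an end, then `mid b` separates it from the rest, so `S` lies in `end b` and
  -- `mid b`. The vertices of `mid b` have no edges among themselves, so they are discarded too, and
  -- `end b` alone is too small. With the ends gone, the neighbours of `mid b` lie in `mid (not b)`,
  -- so nothing is left.
  path-not-KConnected : ⊥
  path-not-KConnected = <⇒≱ (≤-<-trans z≤n (proj₁ conn)) (∣S∣≤ nowhere (cover [] z≤n λ _ ()))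
    where
    at? : ∀ p w → Dec (pos w ≡ p)
    at? p w = pos w ≟ᴾ p

    no-end : ∀ b z → pos z ≡ end b → ¬ InS z
    no-end b z z-end z∈S = <-asym K<k (<-≤-trans (proj₁ conn) (∣S∣≤ all-end (small (end b))))
      where
      closed : ∀ x y → pos x ≡ end b → InS y → χ x y ≡ col → pos y ≡ end b ⊎ pos y ≡ mid b
      closed x y x-end _ eq with pos x | pos y | path x y eq
      closed x y refl _ eq | _ | _ | end~end = inj₁ refl
      closed x y refl _ eq | _ | _ | end~mid = inj₂ refl

      S⊆ : ∀ y → InS y → pos y ≡ end b ⊎ pos y ≡ mid b
      S⊆ = cut (at? (mid b)) (small (mid b)) K<k closed z-end
        (λ z-mid → end≢mid (trans (sym z-end) z-mid)) z∈S
        where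
        end≢mid : end b ≢ mid b
        end≢mid ()

      no-mid : ∀ y → pos y ≡ mid b → ¬ InS y
      no-mid y y-mid = peel-vertex (at? (end b)) (small (end b)) K<k
        (λ y-end → mid≢end (trans (sym y-mid) y-end)) nbrs
        where
        mid≢end : mid b ≢ end b
        mid≢end ()
        nbrs : ∀ x → InS x → χ y x ≡ col → pos x ≡ end b
        nbrs x x∈S eq with S⊆ x x∈S
        ... | inj₁ x-end = x-end
        ... | inj₂ x-mid = ⊥-elim (¬mid~mid (subst (_~ mid b) y-mid (subst (pos y ~_) x-mid (path y x eq))))

      all-end : ∀ y → InS y → pos y ≡ end b
      all-end y y∈S with S⊆ y y∈S
      ... | inj₁ y-end = y-end
      ... | inj₂ y-mid = ⊥-elim (no-mid y y-mid y∈S)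

    no-mid : ∀ b z → pos z ≡ mid b → ¬ InS z
    no-mid b z z-mid = peel-vertex (at? (mid (not b))) (small (mid (not b))) K<k
      (λ z-mid′ → other b (trans (sym z-mid) z-mid′)) nbrs
      where
      other : ∀ b → mid b ≢ mid (not b)
      other true ()
      other false ()
      nbrs : ∀ y → InS y → χ z y ≡ col → pos y ≡ mid (not b)
      nbrs y y∈S eq with pos y in y-pos | subst (_~ pos y) z-mid (path z y eq)
      ... | _ | mid~end = ⊥-elim (no-end b y y-pos y∈S)
      ... | _ | mid~mid = refl

    nowhere : ∀ w → InS w → ⊥
    nowhere w with pos w in w-pos
    ... | end b = no-end b w w-pos
    ... | mid b = no-mid b w w-pos

-- The colouring with four blocks.

split-≤ : ∀ {n K M} → n ≤ K + M → ∃ λ a → ∃ λ b → a ≤ K × b ≤ M × a + b ≡ n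
split-≤ {n} {K} n≤K+M = K ⊓ n , n ∸ K , m⊓n≤m K n , m≤n+o⇒m∸n≤o n K n≤K+M , m⊓n+n∸m≡n K n

module FourBlocks {k K : ℕ} (K<k : K < k) {a₁ a₂ a₃ a₄ : ℕ}
  (a₁≤K : a₁ ≤ K) (a₂≤K : a₂ ≤ K) (a₃≤K : a₃ ≤ K) (a₄≤K : a₄ ≤ K) where

  W : Set
  W = Fin a₁ ⊎ Fin a₂ ⊎ Fin a₃ ⊎ Fin a₄

  pattern A₁ i = inj₁ i
  pattern A₂ i = inj₂ (inj₁ i)
  pattern A₃ i = inj₂ (inj₂ (inj₁ i))
  pattern A₄ i = inj₂ (inj₂ (inj₂ i))

  iso : Fin (a₁ + (a₂ + (a₃ + a₄))) ↔ W
  iso = ↔-trans +↔⊎ (↔-refl ⊎-↔ ↔-trans +↔⊎ (↔-refl ⊎-↔ +↔⊎))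

  -- Each red pair of blocks is listed in one order only; `χ` symmetrises.
  red : W → W → Bool
  red (A₁ _) (A₁ _) = true
  red (A₁ _) (A₂ _) = true
  red (A₂ _) (A₃ _) = true
  red (A₃ _) (A₄ _) = true
  red (A₄ _) (A₄ _) = true
  red _      _      = false

  χ : W → W → Bool
  χ x y = red x y ∨ red y x

  χ-sym : ∀ x y → χ x y ≡ χ y x
  χ-sym x y = ∨-comm (red x y) (red y x)

  -- Since P₄ is self-complementary, the blocks form a path in either colour.
  pos : Bool → W → Pos
  pos true  (A₁ _) = end true
  pos true  (A₂ _) = mid true
  pos true  (A₃ _) = mid false
  pos true  (A₄ _) = end false
  pos false (A₁ _) = mid false
  pos false (A₂ _) = end true
  pos false (A₃ _) = end false
  pos false (A₄ _) = mid true

  path : ∀ col x y → χ x y ≡ col → pos col x ~ pos col y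
  path _ (A₁ _) (A₁ _) refl = end~end
  path _ (A₁ _) (A₂ _) refl = end~mid
  path _ (A₁ _) (A₃ _) refl = mid~end
  path _ (A₁ _) (A₄ _) refl = mid~mid
  path _ (A₂ _) (A₁ _) refl = mid~end
  path _ (A₂ _) (A₂ _) refl = end~end
  path _ (A₂ _) (A₃ _) refl = mid~mid
  path _ (A₂ _) (A₄ _) refl = end~mid
  path _ (A₃ _) (A₁ _) refl = end~mid
  path _ (A₃ _) (A₂ _) refl = mid~mid
  path _ (A₃ _) (A₃ _) refl = end~end
  path _ (A₃ _) (A₄ _) refl = mid~end
  path _ (A₄ _) (A₁ _) refl = mid~mid
  path _ (A₄ _) (A₂ _) refl = mid~end
  path _ (A₄ _) (A₃ _) refl = end~mid
  path _ (A₄ _) (A₄ _) refl = end~end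

  small : ∀ col p → AtMost (λ w → pos col w ≡ p) K
  small true  (end true)  = atMost-block (λ i → A₁ i) a₁≤K λ { (A₁ i) _ → i , refl ; (A₂ _) () ; (A₃ _) () ; (A₄ _) () }
  small true  (mid true)  = atMost-block (λ i → A₂ i) a₂≤K λ { (A₂ i) _ → i , refl ; (A₃ _) () ; (A₄ _) () }
  small true  (mid false) = atMost-block (λ i → A₃ i) a₃≤K λ { (A₃ i) _ → i , refl }
  small true  (end false) = atMost-block (λ i → A₄ i) a₄≤K λ { (A₄ i) _ → i , refl }
  small false (mid false) = atMost-block (λ i → A₁ i) a₁≤K λ { (A₁ i) _ → i , refl ; (A₂ _) () ; (A₃ _) () ; (A₄ _) () }
  small false (end true)  = atMost-block (λ i → A₂ i) a₂≤K λ { (A₂ i) _ → i , refl ; (A₃ _) () ; (A₄ _) () }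
  small false (end false) = atMost-block (λ i → A₃ i) a₃≤K λ { (A₃ i) _ → i , refl }
  small false (mid true)  = atMost-block (λ i → A₄ i) a₄≤K λ { (A₄ i) _ → i , refl }

  avoidable : Avoidable k (a₁ + (a₂ + (a₃ + a₄)))
  avoidable = (λ u v → χ (Inverse.to iso u) (Inverse.to iso v)) ,
    (λ u v → χ-sym (Inverse.to iso u) (Inverse.to iso v)) ,
    λ col S E mono conn _ → path-not-KConnected iso χ χ-sym mono conn K<k (pos col) (small col) (path col)

avoidable-≤4K : ∀ {K n} → n ≤ K + (K + (K + K)) → Avoidable (suc K) n
avoidable-≤4K {K} n≤4K with split-≤ {K = K} n≤4K
... | a₁ , _ , a₁≤K , n≤3K , refl with split-≤ {K = K} n≤3K
...   | a₂ , _ , a₂≤K , n≤2K , refl with split-≤ {K = K} n≤2K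
...     | a₃ , a₄ , a₃≤K , a₄≤K , refl = FourBlocks.avoidable ≤-refl a₁≤K a₂≤K a₃≤K a₄≤K

-- The colouring with five blocks.

order : (μ a₁ a₂ a₃ a₄ b : ℕ) → ℕ
order μ a₁ a₂ a₃ a₄ b = suc μ + (a₁ + (a₂ + (suc μ + (a₃ + (a₄ + b)))))

-- The part U of A₁ and the part T of A₃ have one vertex for each of the 1 + μ pieces
-- of A₄ and of A₂; A₁ and A₃ below stand for what remains of the two blocks.
module FiveBlocks {k μ ρ a₁ a₂ a₃ a₄ b : ℕ}
  (A₁-small : suc μ + a₁ < k) (A₂-small : a₂ < k) (A₃-small : suc μ + a₃ + μ < k) (A₄-small : a₄ + μ < k)
  (B-small : ρ + b < k)
  (pieces₂ : Pieces a₂ (suc μ) ρ) (pieces₄ : Pieces a₄ (suc μ) ρ)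
  -- For a large `S`, `M + 2 * k < n + 2` means `M < ∣ S ∣`. The first two bounds allow discarding
  -- `A₁` in red and `A₃` in blue as whole blocks; the last two contradict the number of vertices
  -- that survive in each colour.
  (n>A₁+A₂ : suc μ + a₁ + a₂ + 2 * k < order μ a₁ a₂ a₃ a₄ b + 2)
  (n>A₁+A₃ : suc μ + a₃ + (suc μ + a₁) + 2 * k < order μ a₁ a₂ a₃ a₄ b + 2)
  (n>blue : a₁ + (a₄ + b) + 2 * k < order μ a₁ a₂ a₃ a₄ b + 2)
  (n>red : a₂ + (a₃ + b) + 2 * k < order μ a₁ a₂ a₃ a₄ b + 2) where

  m n : ℕ
  m = suc μ
  n = order μ a₁ a₂ a₃ a₄ b

  W : Set
  W = Fin m ⊎ Fin a₁ ⊎ Fin a₂ ⊎ Fin m ⊎ Fin a₃ ⊎ Fin a₄ ⊎ Fin b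

  pattern U i  = inj₁ i
  pattern A₁ i = inj₂ (inj₁ i)
  pattern A₂ i = inj₂ (inj₂ (inj₁ i))
  pattern T i  = inj₂ (inj₂ (inj₂ (inj₁ i)))
  pattern A₃ i = inj₂ (inj₂ (inj₂ (inj₂ (inj₁ i))))
  pattern A₄ i = inj₂ (inj₂ (inj₂ (inj₂ (inj₂ (inj₁ i)))))
  pattern B i  = inj₂ (inj₂ (inj₂ (inj₂ (inj₂ (inj₂ i)))))

  iso : Fin n ↔ W
  iso = ↔-trans +↔⊎ (↔-refl ⊎-↔ ↔-trans +↔⊎ (↔-refl ⊎-↔ ↔-trans +↔⊎ (↔-refl ⊎-↔
        ↔-trans +↔⊎ (↔-refl ⊎-↔ ↔-trans +↔⊎ (↔-refl ⊎-↔ +↔⊎)))))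

  piece₂ : Fin a₂ → Fin m
  piece₂ = proj₁ pieces₂

  piece₄ : Fin a₄ → Fin m
  piece₄ = proj₁ pieces₄

  red : W → W → Bool
  red (U _)  (U _)  = true
  red (U _)  (A₁ _) = true
  red (A₁ _) (A₁ _) = true
  red (U _)  (A₂ _) = true
  red (A₁ _) (A₂ _) = true
  red (A₂ _) (A₂ _) = true
  red (T j)  (A₂ x) = does (piece₂ x Fin.≟ j)
  red (A₂ _) (A₃ _) = true
  red (T _)  (A₄ _) = true
  red (A₃ _) (A₄ _) = true
  red (U j)  (A₄ x) = not (does (piece₄ x Fin.≟ j))
  red (A₂ _) (B _)  = true
  red (T _)  (B _)  = true
  red (A₃ _) (B _)  = true
  red _      _      = false

  χ : W → W → Bool
  χ x y = red x y ∨ red y x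

  χ-sym : ∀ x y → χ x y ≡ χ y x
  χ-sym x y = ∨-comm (red x y) (red y x)

  isA₁ isA₂ isA₃ : W → Bool
  isA₁ (U _)  = true
  isA₁ (A₁ _) = true
  isA₁ _      = false
  isA₂ (A₂ _) = true
  isA₂ _      = false
  isA₃ (T _)  = true
  isA₃ (A₃ _) = true
  isA₃ _      = false

  ∣A₁∣ : AtMost (Bool.T ∘ isA₁) (m + a₁)
  ∣A₁∣ = atMost-∪ (λ { (U i) _ → inj₁ (i , refl) ; (A₁ i) _ → inj₂ (i , refl) })
    (atMost-range λ i → U i) (atMost-range λ i → A₁ i)

  ∣A₂∣ : AtMost (Bool.T ∘ isA₂) a₂
  ∣A₂∣ = atMost-⊆ (λ { (A₂ i) _ → i , refl }) (atMost-range λ i → A₂ i)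

  ∣A₃∣ : AtMost (Bool.T ∘ isA₃) (m + a₃)
  ∣A₃∣ = atMost-∪ (λ { (T i) _ → inj₁ (i , refl) ; (A₃ i) _ → inj₂ (i , refl) })
    (atMost-range λ i → T i) (atMost-range λ i → A₃ i)

  -- `blueA₂ i` and `redA₄ i` are the full neighbourhoods, in the named colour, of a vertex of the
  -- `i`-th piece. `blueU j` and `redT j` are what remains of the neighbourhoods of `U j` and `T j`
  -- after the earlier discards. Boolean values let `T?` decide membership.
  blueA₂ blueU redA₄ redT : Fin m → W → Bool
  blueA₂ i (A₄ _) = true
  blueA₂ i (T j)  = not (does (i Fin.≟ j))
  blueA₂ i _      = false
  blueU  j (A₄ x) = does (piece₄ x Fin.≟ j)
  blueU  j (B _)  = true
  blueU  j _      = false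
  redA₄  i (U j)  = not (does (i Fin.≟ j))
  redA₄  i (T _)  = true
  redA₄  i (A₃ _) = true
  redA₄  i _      = false
  redT   j (A₂ x) = does (piece₂ x Fin.≟ j)
  redT   j (B _)  = true
  redT   j _      = false

  ∣blueA₂∣ : ∀ i → AtMost (Bool.T ∘ blueA₂ i) (a₄ + μ)
  ∣blueA₂∣ i = atMost-∪ split (atMost-range λ x → A₄ x) (atMost-image (λ j → T j) (atMost-≢ i))
    where
    split : ∀ w → Bool.T (blueA₂ i w) → Range (λ x → A₄ x) w ⊎ Image (λ j → T j) (_≢ i) w
    split (A₄ x) _ = inj₁ (x , refl)
    split (T j)  q with i Fin.≟ j
    ... | no i≢j = inj₂ (j , i≢j ∘ sym , refl)

  ∣redA₄∣ : ∀ i → AtMost (Bool.T ∘ redA₄ i) (m + a₃ + μ)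
  ∣redA₄∣ i = atMost-∪ split ∣A₃∣ (atMost-image (λ j → U j) (atMost-≢ i))
    where
    split : ∀ w → Bool.T (redA₄ i w) → Bool.T (isA₃ w) ⊎ Image (λ j → U j) (_≢ i) w
    split (T _)  _ = inj₁ _
    split (A₃ _) _ = inj₁ _
    split (U j)  q with i Fin.≟ j
    ... | no i≢j = inj₂ (j , i≢j ∘ sym , refl)

  ∣blueU∣ : ∀ j → AtMost (Bool.T ∘ blueU j) (ρ + b)
  ∣blueU∣ j = atMost-∪ split (atMost-image (λ x → A₄ x) (proj₂ pieces₄ j)) (atMost-range λ x → B x)
    where
    split : ∀ w → Bool.T (blueU j w) → Image (λ x → A₄ x) (λ x → piece₄ x ≡ j) w ⊎ Range (λ x → B x) w
    split (A₄ x) q with yes x∈j ← piece₄ x Fin.≟ j = inj₁ (x , x∈j , refl)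
    split (B x)  _ = inj₂ (x , refl)

  ∣redT∣ : ∀ j → AtMost (Bool.T ∘ redT j) (ρ + b)
  ∣redT∣ j = atMost-∪ split (atMost-image (λ x → A₂ x) (proj₂ pieces₂ j)) (atMost-range λ x → B x)
    where
    split : ∀ w → Bool.T (redT j w) → Image (λ x → A₂ x) (λ x → piece₂ x ≡ j) w ⊎ Range (λ x → B x) w
    split (A₂ x) q with yes x∈j ← piece₂ x Fin.≟ j = inj₁ (x , x∈j , refl)
    split (B x)  _ = inj₂ (x , refl)

  module _ {S : Subset n} {E : Fin n → Fin n → Set} (large : n + 2 ≤ ∣ S ∣ + 2 * k) where

    <∣S∣ : ∀ {M} → M + 2 * k < n + 2 → M < ∣ S ∣
    <∣S∣ lt = +-cancelʳ-< (2 * k) _ _ (<-≤-trans lt large)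

    no-blue : MonochromaticSubgraph (λ u v → χ (Inverse.to iso u) (Inverse.to iso v)) false S E →
      KConnected k S E → ⊥
    no-blue mono conn = <⇒≱ (<∣S∣ n>blue) (∣S∣≤ rest (atMost-∪ (λ _ q → q) (atMost-range λ i → A₁ i)
        (atMost-∪ (λ _ q → q) (atMost-range λ i → A₄ i) (atMost-range λ i → B i))))
      where
      open Peeling iso χ χ-sym mono conn

      no-A₂ : ∀ x → ¬ InS (A₂ x)
      no-A₂ x = peel-vertex {z = A₂ x} (T? ∘ blueA₂ (piece₂ x)) (∣blueA₂∣ (piece₂ x)) A₄-small (λ ()) nbrs
        where
        nbrs : ∀ y → InS y → χ (A₂ x) y ≡ false → Bool.T (blueA₂ (piece₂ x) y)
        nbrs (T j)  _ eq rewrite eq = _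
        nbrs (A₄ _) _ _ = _

      no-A₃ : ∀ z → Bool.T (isA₃ z) → ¬ InS z
      -- `A₃` with `T` is a blue clique, so it is cut off as a whole. The recoloured edges from `T`
      -- lead into `A₂`, which is already gone.
      no-A₃ = peel-set (T? ∘ isA₁) ∣A₃∣ ∣A₁∣ A₁-small (<∣S∣ n>A₁+A₃) closed
        (λ { (T _) _ () ; (A₃ _) _ () })
        where
        closed : ∀ x y → Bool.T (isA₃ x) → InS y → χ x y ≡ false → Bool.T (isA₃ y) ⊎ Bool.T (isA₁ y)
        closed _      (U _)  _ _   _ = inj₂ _
        closed _      (A₁ _) _ _   _ = inj₂ _
        closed _      (A₂ y) _ y∈S _ = ⊥-elim (no-A₂ y y∈S)
        closed _      (T _)  _ _   _ = inj₁ _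
        closed _      (A₃ _) _ _   _ = inj₁ _
        closed (T _)  (A₄ _) _ _   ()
        closed (A₃ _) (A₄ _) _ _   ()
        closed (T _)  (B _)  _ _   ()
        closed (A₃ _) (B _)  _ _   ()

      no-U : ∀ j → ¬ InS (U j)
      no-U j = peel-vertex {z = U j} (T? ∘ blueU j) (∣blueU∣ j) B-small (λ ()) nbrs
        where
        nbrs : ∀ y → InS y → χ (U j) y ≡ false → Bool.T (blueU j y)
        nbrs (T y)  y∈S _  = ⊥-elim (no-A₃ (T y) _ y∈S)
        nbrs (A₃ y) y∈S _  = ⊥-elim (no-A₃ (A₃ y) _ y∈S)
        nbrs (A₄ x) _   eq with does (piece₄ x Fin.≟ j)
        ... | true = _
        nbrs (B _)  _   _  = _

      rest : ∀ w → InS w → Range (λ i → A₁ i) w ⊎ Range (λ i → A₄ i) w ⊎ Range (λ i → B i) w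
      rest (U i)  w∈S = ⊥-elim (no-U i w∈S)
      rest (A₁ i) w∈S = inj₁ (i , refl)
      rest (A₂ i) w∈S = ⊥-elim (no-A₂ i w∈S)
      rest (T i)  w∈S = ⊥-elim (no-A₃ (T i) _ w∈S)
      rest (A₃ i) w∈S = ⊥-elim (no-A₃ (A₃ i) _ w∈S)
      rest (A₄ i) w∈S = inj₂ (inj₁ (i , refl))
      rest (B i)  w∈S = inj₂ (inj₂ (i , refl))

    no-red : MonochromaticSubgraph (λ u v → χ (Inverse.to iso u) (Inverse.to iso v)) true S E →
      KConnected k S E → ⊥
    no-red mono conn = <⇒≱ (<∣S∣ n>red) (∣S∣≤ rest (atMost-∪ (λ _ q → q) (atMost-range λ i → A₂ i)
        (atMost-∪ (λ _ q → q) (atMost-range λ i → A₃ i) (atMost-range λ i → B i))))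
      where
      open Peeling iso χ χ-sym mono conn

      no-A₄ : ∀ x → ¬ InS (A₄ x)
      no-A₄ x = peel-vertex {z = A₄ x} (T? ∘ redA₄ (piece₄ x)) (∣redA₄∣ (piece₄ x)) A₃-small (λ ()) nbrs
        where
        nbrs : ∀ y → InS y → χ (A₄ x) y ≡ true → Bool.T (redA₄ (piece₄ x) y)
        nbrs (U j)  _ eq rewrite eq = _
        nbrs (T _)  _ _ = _
        nbrs (A₃ _) _ _ = _

      no-A₁ : ∀ z → Bool.T (isA₁ z) → ¬ InS z
      -- The red mirror image: the recoloured edges from `U` lead into `A₄`, already discarded, so
      -- only `A₂` borders the red clique formed by `A₁` and `U`.
      no-A₁ = peel-set (T? ∘ isA₂) ∣A₁∣ ∣A₂∣ A₂-small (<∣S∣ n>A₁+A₂) closed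
        (λ { (U _) _ () ; (A₁ _) _ () })
        where
        closed : ∀ x y → Bool.T (isA₁ x) → InS y → χ x y ≡ true → Bool.T (isA₁ y) ⊎ Bool.T (isA₂ y)
        closed _      (U _)  _ _   _ = inj₁ _
        closed _      (A₁ _) _ _   _ = inj₁ _
        closed _      (A₂ _) _ _   _ = inj₂ _
        closed (U _)  (T _)  _ _   ()
        closed (A₁ _) (T _)  _ _   ()
        closed (U _)  (A₃ _) _ _   ()
        closed (A₁ _) (A₃ _) _ _   ()
        closed _      (A₄ y) _ y∈S _ = ⊥-elim (no-A₄ y y∈S)
        closed (U _)  (B _)  _ _   ()
        closed (A₁ _) (B _)  _ _   ()

      no-T : ∀ j → ¬ InS (T j)
      no-T j = peel-vertex {z = T j} (T? ∘ redT j) (∣redT∣ j) B-small (λ ()) nbrs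
        where
        nbrs : ∀ y → InS y → χ (T j) y ≡ true → Bool.T (redT j y)
        nbrs (U y)  y∈S _  = ⊥-elim (no-A₁ (U y) _ y∈S)
        nbrs (A₁ y) y∈S _  = ⊥-elim (no-A₁ (A₁ y) _ y∈S)
        nbrs (A₂ x) _   eq with does (piece₂ x Fin.≟ j)
        ... | true = _
        nbrs (A₄ y) y∈S _  = ⊥-elim (no-A₄ y y∈S)
        nbrs (B _)  _   _  = _

      rest : ∀ w → InS w → Range (λ i → A₂ i) w ⊎ Range (λ i → A₃ i) w ⊎ Range (λ i → B i) w
      rest (U i)  w∈S = ⊥-elim (no-A₁ (U i) _ w∈S)
      rest (A₁ i) w∈S = ⊥-elim (no-A₁ (A₁ i) _ w∈S)
      rest (A₂ i) w∈S = inj₁ (i , refl)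
      rest (T i)  w∈S = ⊥-elim (no-T i w∈S)
      rest (A₃ i) w∈S = inj₂ (inj₁ (i , refl))
      rest (A₄ i) w∈S = ⊥-elim (no-A₄ i w∈S)
      rest (B i)  w∈S = inj₂ (inj₂ (i , refl))

  avoidable : Avoidable k n
  avoidable = (λ u v → χ (Inverse.to iso u) (Inverse.to iso v)) ,
    (λ u v → χ-sym (Inverse.to iso u) (Inverse.to iso v)) ,
    λ { false S E mono conn large → no-blue large mono conn
      ; true  S E mono conn large → no-red large mono conn }

-- Choice of the parameters.

even-or-odd : ∀ n → ∃ λ a → n ≡ a + a ⊎ n ≡ suc (a + a)
even-or-odd zero    = 0 , inj₁ refl
even-or-odd (suc n) with even-or-odd n
... | a , inj₁ refl = a , inj₂ refl
... | a , inj₂ refl = suc a , inj₁ (cong suc (sym (+-suc a a)))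

-- Take 2m = ρ = s for even s, and 2m = s + 1, ρ = s − 1 for odd s.
sqrt-factors : ∀ {k} s → 1 ≤ k → 2 * k ∸ 1 ≤ s * s →
  ∃ λ μ → ∃ λ ρ → 2 * suc μ + ρ ≡ 2 * s × k ≤ suc (suc μ * ρ)
sqrt-factors {suc K} zero _ 2k-1≤0 with () ← ≤-trans (≤-reflexive (sym (+-suc K (K + 0)))) 2k-1≤0
sqrt-factors {k} (suc s) _ 2k-1≤s² with even-or-odd s
-- For an odd root `1 + 2a` the square plus one equals `2(1 + mρ)` exactly.
... | a , inj₁ refl = a , a + a , width a , *-cancelˡ-≤ 2 (≤-trans (m≤n+m∸n (2 * k) 1)
    (≤-trans (s≤s 2k-1≤s²) (≤-reflexive (area a))))
  where
  width : ∀ a → 2 * suc a + (a + a) ≡ 2 * suc (a + a)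
  width = solve-∀
  area : ∀ a → suc (suc (a + a) * suc (a + a)) ≡ 2 * suc (suc a * (a + a))
  area = solve-∀
-- For an even root the square plus one is one less than `2(1 + mρ)`, hence the extra `n≤1+n`.
... | a , inj₂ refl = a , suc (suc (a + a)) , width a , *-cancelˡ-≤ 2 (≤-trans (m≤n+m∸n (2 * k) 1)
    (≤-trans (s≤s 2k-1≤s²) (≤-trans (n≤1+n _) (≤-reflexive (area a)))))
  where
  width : ∀ a → 2 * suc a + suc (suc (a + a)) ≡ 2 * suc (suc (a + a))
  width = solve-∀
  area : ∀ a → suc (suc (suc (suc (a + a)) * suc (suc (a + a)))) ≡ 2 * suc (suc a * suc (suc (a + a)))
  area = solve-∀

-- Parametrising by the excess `e` of `k` over `2m + ρ`, with `m = suc μ`, makes every block size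
-- subtraction-free. `a₁` and `a₃` omit the `m` vertices of `U` and `T`.
module _ (μ ρ e : ℕ) where

  private
    k a₁ a₂ a₃ a₄ b n : ℕ
    k  = 2 * suc μ + ρ + e
    a₁ = μ + ρ + e
    a₂ = suc (μ + μ) + ρ + e
    a₃ = ρ + e
    a₄ = suc μ + ρ + e
    b  = suc (μ + μ) + e
    n  = order μ a₁ a₂ a₃ a₄ b

  avoidable-factors : k ≤ suc (suc μ * ρ) → Avoidable k (5 * k ∸ (2 * suc μ + ρ) ∸ 3)
  avoidable-factors k≤1+mρ = subst (Avoidable k) n≡ (FiveBlocks.avoidable
    (≤-reflexive (A₁-size μ ρ e)) (≤-reflexive (A₂-size μ ρ e)) (≤-reflexive (A₃-size μ ρ e))
    (≤-reflexive (A₄-size μ ρ e)) (≤-reflexive (B-size μ ρ e))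
    (pieces a₂≤mρ) (pieces (≤-trans a₄≤a₂ a₂≤mρ))
    (m+n≤o⇒m≤o _ (≤-reflexive (A₁+A₂ μ ρ e))) (m+n≤o⇒m≤o _ (≤-reflexive (A₁+A₃ μ ρ e)))
    -- Equality holds in both colours: the survivors number `n - 2k + 1`, exactly one below the
    -- threshold.
    (≤-reflexive (blue μ ρ e)) (≤-reflexive (red μ ρ e)))
    where
    A₁-size : ∀ μ ρ e → suc (suc μ + (μ + ρ + e)) ≡ 2 * suc μ + ρ + e
    A₁-size = solve-∀
    A₂-size : ∀ μ ρ e → suc (suc (μ + μ) + ρ + e) ≡ 2 * suc μ + ρ + e
    A₂-size = solve-∀
    A₃-size : ∀ μ ρ e → suc (suc μ + (ρ + e) + μ) ≡ 2 * suc μ + ρ + e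
    A₃-size = solve-∀
    A₄-size : ∀ μ ρ e → suc (suc μ + ρ + e + μ) ≡ 2 * suc μ + ρ + e
    A₄-size = solve-∀
    B-size : ∀ μ ρ e → suc (ρ + (suc (μ + μ) + e)) ≡ 2 * suc μ + ρ + e
    B-size = solve-∀

    a₂≤mρ : a₂ ≤ suc μ * ρ
    a₂≤mρ = s≤s⁻¹ (≤-trans (≤-reflexive (A₂-size μ ρ e)) k≤1+mρ)
    a₄≤a₂ : a₄ ≤ a₂
    a₄≤a₂ = +-monoˡ-≤ e (+-monoˡ-≤ ρ (s≤s (m≤m+n μ μ)))

    total : ∀ μ ρ e → 5 * (2 * suc μ + ρ + e) ≡
      suc μ + (μ + ρ + e + (suc (μ + μ) + ρ + e + (suc μ + (ρ + e + (suc μ + ρ + e + (suc (μ + μ) + e)))))) +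
      (2 * suc μ + ρ + 3)
    total = solve-∀

    n≡ : n ≡ 5 * k ∸ (2 * suc μ + ρ) ∸ 3
    n≡ = begin
      n                                                 ≡⟨ m+n∸n≡m n (2 * suc μ + ρ + 3) ⟨
      n + (2 * suc μ + ρ + 3) ∸ (2 * suc μ + ρ + 3)     ≡⟨ cong (_∸ (2 * suc μ + ρ + 3)) (total μ ρ e) ⟨
      5 * k ∸ (2 * suc μ + ρ + 3)                       ≡⟨ ∸-+-assoc (5 * k) (2 * suc μ + ρ) 3 ⟨
      5 * k ∸ (2 * suc μ + ρ) ∸ 3                       ∎
      where open ≡-Reasoning

    A₁+A₂ : ∀ μ ρ e → suc (suc μ + (μ + ρ + e) + (suc (μ + μ) + ρ + e) + 2 * (2 * suc μ + ρ + e)) + e ≡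
      suc μ + (μ + ρ + e + (suc (μ + μ) + ρ + e + (suc μ + (ρ + e + (suc μ + ρ + e + (suc (μ + μ) + e)))))) + 2
    A₁+A₂ = solve-∀
    A₁+A₃ : ∀ μ ρ e → suc (suc μ + (ρ + e) + (suc μ + (μ + ρ + e)) + 2 * (2 * suc μ + ρ + e)) + (μ + e) ≡
      suc μ + (μ + ρ + e + (suc (μ + μ) + ρ + e + (suc μ + (ρ + e + (suc μ + ρ + e + (suc (μ + μ) + e)))))) + 2
    A₁+A₃ = solve-∀
    blue : ∀ μ ρ e → suc (μ + ρ + e + (suc μ + ρ + e + (suc (μ + μ) + e)) + 2 * (2 * suc μ + ρ + e)) ≡
      suc μ + (μ + ρ + e + (suc (μ + μ) + ρ + e + (suc μ + (ρ + e + (suc μ + ρ + e + (suc (μ + μ) + e)))))) + 2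
    blue = solve-∀
    red : ∀ μ ρ e → suc (suc (μ + μ) + ρ + e + (ρ + e + (suc (μ + μ) + e)) + 2 * (2 * suc μ + ρ + e)) ≡
      suc μ + (μ + ρ + e + (suc (μ + μ) + ρ + e + (suc μ + (ρ + e + (suc μ + ρ + e + (suc (μ + μ) + e)))))) + 2
    red = solve-∀

avoidable-2s≤k : ∀ {k} s → 1 ≤ k → 2 * k ∸ 1 ≤ s * s → 2 * s ≤ k → Avoidable k (5 * k ∸ 2 * s ∸ 3)
avoidable-2s≤k s 1≤k 2k-1≤s² 2s≤k with sqrt-factors s 1≤k 2k-1≤s² | m≤n⇒∃[o]m+o≡n 2s≤k
... | μ , ρ , 2m+ρ≡2s , k≤1+mρ | e , refl rewrite sym 2m+ρ≡2s = avoidable-factors μ ρ e k≤1+mρ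

theorem1 : ∀ (k : ℕ) → 1 ≤ k → ∀ (s : ℕ) → IsCeilSqrt (2 * k ∸ 1) s →
    Σ (Coloring (5 * k ∸ 2 * s ∸ 3)) λ c → Symmetric c ×
    (∀ (col : Bool) (S : Subset (5 * k ∸ 2 * s ∸ 3))
    (E : Fin (5 * k ∸ 2 * s ∸ 3) → Fin (5 * k ∸ 2 * s ∸ 3) → Set) →
    MonochromaticSubgraph c col S E → KConnected k S E →
    (5 * k ∸ 2 * s ∸ 3) + 2 ≤ ∣ S ∣ + 2 * k → ⊥)
theorem1 k 1≤k s (2k-1≤s² , _) with 2 * s ≤? k
... | yes 2s≤k = avoidable-2s≤k s 1≤k 2k-1≤s² 2s≤k
theorem1 (suc K) _ s _ | no 2s≰k = avoidable-≤4K (begin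
  -- Here `2 * s` is at least `k + 1`, which is `2 + K`, so the order is at most
  -- `5k - (k + 1) - 3 = 4(k - 1)`.
  5 * suc K ∸ 2 * s ∸ 3                         ≤⟨ ∸-monoˡ-≤ 3 (∸-monoʳ-≤ (5 * suc K) (≰⇒> 2s≰k)) ⟩
  5 * suc K ∸ (2 + K) ∸ 3                       ≡⟨ ∸-+-assoc (5 * suc K) (2 + K) 3 ⟩
  5 * suc K ∸ (2 + K + 3)                       ≡⟨ cong (_∸ (2 + K + 3)) (identity K) ⟩
  K + (K + (K + K)) + (2 + K + 3) ∸ (2 + K + 3) ≡⟨ m+n∸n≡m (K + (K + (K + K))) (2 + K + 3) ⟩
  K + (K + (K + K))                             ∎)
  where
  open ≤-Reasoning
  identity : ∀ K → 5 * suc K ≡ K + (K + (K + K)) + (2 + K + 3)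
  identity = solve-∀
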